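{- Let $M$ be a transversal matroid of rank $r$. If the presentations $\mathcal{A}=(A_i:i\in[r])$ and $\mathcal{B}=(B_i:i\in[r])$ of $M$ differ by more than just reindexing the sets (i.e. there is no permutation $\tau$ of $[r]$ with $B_i=A_{\tau(i)}$ for all $i$), then $|T_\mathcal{A}\cap T_\mathcal{B}|\le\frac34\cdot2^r$. This bound is sharp (there exist such $M$, $\mathcal{A}$, $\mathcal{B}$ attaining equality).
   Context: $[r]=\{1,\dots,r\}$. For a set system $\mathcal{A}=(A_i:i\in[r])$ on a finite set $E$, $M[\mathcal{A}]$ is the transversal matroid on $E$ whose independent sets are the partial transversals of $\mathcal{A}$ (sets $X$ admitting an injection $\phi:X\to[r]$ with $e\in A_{\phi(e)}$); $\mathcal{A}$ is a presentation of $M[\mathcal{A}]$; presentations of a rank-$r$ matroid have exactly $r$ sets. Fix $x\notin E$; for $I\subseteq[r]$, $\mathcal{A}^I$ is obtained from $\mathcal{A}$ by replacing $A_i$ by $A_i\cup\{x\}$ for each $i\in I$. $T_\mathcal{A}=\{M[\mathcal{A}^I]: I\subseteq[r]\}$ is the set of distinct single-element extensions of $M$ (matroids on $E\cup\{x\}$) obtained by extending $\mathcal{A}$; similarly $T_\mathcal{B}$. -}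

module Defs where

open import Data.Nat using (ℕ; suc; _*_; _^_; _≤_)
open import Data.Fin using (Fin)
open import Data.Fin.Subset using (Subset; _∈_; ∣_∣)
open import Data.Fin.Permutation using (Permutation′; _⟨$⟩ʳ_)
open import Data.Vec using (_∷_; lookup)
open import Data.Product using (Σ; ∃; _×_)
open import Data.List using (List; length)
open import Data.List.Relation.Unary.All using (All)
open import Data.List.Relation.Unary.AllPairs using (AllPairs)
open import Relation.Binary.PropositionalEquality using (_≡_)
open import Relation.Nullary using (¬_)
open import Function.Bundles using (_⇔_)

SetSystem : ℕ → ℕ → Set
SetSystem n r = Fin r → Subset n

PartialTransversal : ∀ {n r} → SetSystem n r → Subset n → Set
PartialTransversal {n} {r} A X =
  Σ ((e : Fin n) → e ∈ X → Fin r) λ φ →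
    (∀ e (p : e ∈ X) → e ∈ A (φ e p)) ×
    (∀ e e' (p : e ∈ X) (p' : e' ∈ X) → φ e p ≡ φ e' p' → e ≡ e')

SameMatroid : ∀ {n r s} → SetSystem n r → SetSystem n s → Set
SameMatroid {n} A B = ∀ (X : Subset n) → PartialTransversal A X ⇔ PartialTransversal B X

-- M[A] has rank r (A has r sets): some partial transversal has size r.
HasRank : ∀ {n r} → SetSystem n r → ℕ → Set
HasRank {n} A k = ∃ λ (X : Subset n) → ∣ X ∣ ≡ k × PartialTransversal A X

Reindexing : ∀ {n r} → SetSystem n r → SetSystem n r → Set
Reindexing {r = r} A B = ∃ λ (τ : Permutation′ r) → ∀ i → B i ≡ A (τ ⟨$⟩ʳ i)

-- A^I on ground set Fin (suc n): the new element x is Fin.zero,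
-- and e ∈ E = Fin n is represented by suc e.
extend : ∀ {n r} → SetSystem n r → Subset r → SetSystem (suc n) r
extend A I i = lookup I i ∷ A i

-- M[A^I] ∈ T_B, i.e. M[A^I] ∈ T_A ∩ T_B.
InBoth : ∀ {n r} → SetSystem n r → SetSystem n r → Subset r → Set
InBoth {r = r} A B I = ∃ λ (J : Subset r) → SameMatroid (extend A I) (extend B J)

-- A list of index sets I whose extensions M[A^I] are pairwise distinct
-- matroids lying in T_A ∩ T_B (a family of distinct elements of T_A ∩ T_B).
DistinctCommon : ∀ {n r} → SetSystem n r → SetSystem n r → List (Subset r) → Set
DistinctCommon A B Is =
  All (InBoth A B) Is ×
  AllPairs (λ I I' → ¬ SameMatroid (extend A I) (extend A I')) Is

Hyp : ∀ {n r} → SetSystem n r → SetSystem n r → Set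
Hyp {r = r} A B = HasRank A r × SameMatroid A B × ¬ Reindexing A B

{-# OPTIONS --safe #-}

-- Let N i (resp. N' j) be the family of sets that can be matched without using
-- A i (resp. B j).  The matroid M[A^I] is determined by the union of the N i
-- with i ∈ I.  Let Y be a maximal partial transversal in the complement of A i.
-- If Y ∈ N j for some j ≠ i, then an alternating path argument gives N i ⊆ N j;
-- hence adding i to any I containing j changes nothing, and T_A loses a quarter
-- of its 2^r potential members.  So we may assume that each i has a private set
-- Y i, lying in N k only for k = i, and likewise that each j has one, Y' j,
-- for B.
-- Write Q i i' if Y i ∈ N' j and Y' j ∈ N i' for some j.  If M[A^I] is in T_B,
-- then i ∈ I holds exactly if Q i i' for some i' ∈ I.  An off-diagonal pair of Q
-- therefore forces an implication i' ∈ I → i ∈ I, and without such pairs a gap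
-- on the diagonal forces i ∉ I; both give the bound.  If Q is the identity, the
-- indices j define a permutation σ, and Y' (σ i) is private to i in A and to σ i
-- in B.  As a set is recovered from M and any private set Y as
-- {e ∉ Y : Y + e independent}, A i = B (σ i).

module Submission where

open import Defs
open import Data.Bool using (Bool; true; false)
open import Data.Empty using (⊥)
open import Data.Fin using (Fin; zero; suc; _≟_; punchOut)
open import Data.Fin.Permutation using (permutation; _⟨$⟩ʳ_)
open import Data.Fin.Properties using (any?; all?; injective⇒≤; punchOut-injective; suc-injective)
open import Data.Fin.Subset using (Subset; _∈_; _∉_; _⊆_; _⊂_; _⊃_; _∪_; ⁅_⁆) renaming (_-_ to _−_; ⊥ to ∅)
open import Data.Fin.Subset.Induction using (⊂-wellFounded; ⊃-wellFounded; Acc; acc)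
open import Data.Fin.Subset.Properties using (_∈?_; drop-there; anySubset?; x∈p∧x≢y⇒x∈p-y; p─q⊆p; x∈p⇒p-x⊂p; ∉⊥; x∈p∪q⁻; x∈p∪q⁺; p⊆p∪q; x∈⁅x⁆; x∈⁅y⁆⇒x≡y; ⊆-antisym)
open import Data.List using (List; []; _∷_; length; map)
open import Data.List.Properties using (length-map)
open import Data.List.Relation.Unary.All as All using (All; []; _∷_)
open import Data.List.Relation.Unary.All.Properties as All using ()
open import Data.List.Relation.Unary.AllPairs as AllPairs using (AllPairs; []; _∷_)
open import Data.List.Relation.Unary.AllPairs.Properties as AllPairs using ()
open import Data.List.Relation.Unary.Unique.Propositional using (Unique)
open import Data.Nat using (ℕ; zero; suc; _+_; _*_; _^_; _≤_; z≤n; _≤?_)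
open import Data.Nat.Properties using (+-suc; +-identityʳ; +-mono-≤; *-assoc; *-distribˡ-+; *-monoˡ-≤; *-monoʳ-≤; ≤-refl; ≤-reflexive; ≤-trans; n≤1+n; 1+n≰n; module ≤-Reasoning)
open import Data.Nat.Tactic.RingSolver using (solve-∀)
open import Data.Product using (Σ; ∃; _×_; _,_; proj₁; proj₂)
open import Data.Sum using (_⊎_; inj₁; inj₂)
open import Data.Unit using (tt)
open import Data.Vec using (Vec; []; _∷_; here; there; lookup; tabulate; _[_]≔_)
open import Data.Vec.Properties using ([]=⇒lookup; lookup⇒[]=; lookup∘update; lookup∘update′; lookup∘tabulate)
open import Function using (_∘_; id; mk⇔; Equivalence; Injective)
open import Relation.Binary.PropositionalEquality using (_≡_; _≢_; refl; sym; trans; cong; subst)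
open import Relation.Nullary using (¬_; Dec; yes; no; contradiction)
open import Relation.Nullary.Decidable using (decidable-stable; map′; toWitness; _×-dec_; _→-dec_; ¬?)
open import Relation.Unary using (Decidable)

open Equivalence using (to; from)

private
  variable
    n r : ℕ

-- Matchings and alternating paths.

Incidence : ℕ → ℕ → Set₁
Incidence n r = Fin n → Fin r → Set

-- The index function is total, with arbitrary values outside `X`, so that it can be restricted or
-- changed at one element without carrying membership proofs.
record Matching {n r : ℕ} (R : Incidence n r) (X : Fin n → Set) : Set where
  constructor matching
  field
    index     : Fin n → Fin r
    incident  : ∀ e → X e → R e (index e)
    injective : ∀ e e' → X e → X e' → index e ≡ index e' → e ≡ e'

open Matching using (index)

infixl 6 _∖_
-- The deleted index stays in `Fin r` and only loses its incidences, so deletions can be iterated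
-- and permuted without renumbering.
_∖_ : Incidence n r → Fin r → Incidence n r
(R ∖ k) e l = R e l × l ≢ k

mono : {R S : Incidence n r} {X Y : Fin n → Set} →
       (∀ {e l} → R e l → S e l) → (∀ {e} → Y e → X e) → Matching R X → Matching S Y
mono R⊆S Y⊆X (matching f ok inj) =
  matching f (λ e y → R⊆S (ok e (Y⊆X y))) λ e e' y y' → inj e e' (Y⊆X y) (Y⊆X y')

insert : {R : Incidence n r} {X W : Fin n → Set} (z : Fin n) (k : Fin r) →
         (∀ {e} → W e → e ≢ z → X e) → R z k → Matching (R ∖ k) X → Matching R W
insert {n} {r} {R} {X} {W} z k W⊆X Rzk (matching f ok inj) = matching g g-ok g-inj
  where
  g : Fin n → Fin r
  g e with e ≟ z
  ... | yes _ = k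
  ... | no  _ = f e

  g-ok : ∀ e → W e → R e (g e)
  g-ok e w with e ≟ z
  ... | yes refl = Rzk
  ... | no  e≢z  = proj₁ (ok e (W⊆X w e≢z))

  g-inj : ∀ e e' → W e → W e' → g e ≡ g e' → e ≡ e'
  g-inj e e' w w' eq with e ≟ z | e' ≟ z
  ... | yes refl | yes refl = refl
  ... | yes refl | no e'≢z  = contradiction (sym eq) (proj₂ (ok e' (W⊆X w' e'≢z)))
  ... | no e≢z   | yes refl = contradiction eq (proj₂ (ok e (W⊆X w e≢z)))
  ... | no e≢z   | no e'≢z  = inj e e' (W⊆X w e≢z) (W⊆X w' e'≢z) eq

delete : {R : Incidence n r} {X W : Fin n → Set} (z : Fin n) → X z →
         (∀ {e} → W e → X e × e ≢ z) → (m : Matching R X) → Matching (R ∖ index m z) W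
delete z Xz W⊆X (matching f ok inj) = matching f
  (λ e w → let (x , e≢z) = W⊆X w in ok e x , λ eq → e≢z (inj e z x Xz eq))
  λ e e' w w' → inj e e' (proj₁ (W⊆X w)) (proj₁ (W⊆X w'))

y∉p−y : (p : Subset n) (y : Fin n) → y ∉ p − y
y∉p−y (_ ∷ p) zero    ()
y∉p−y (_ ∷ p) (suc y) (there y∈) = y∉p−y p y y∈

-- Follows the alternating path of f and g from j: each step removes an element
-- together with the index that f assigns to it, and inserts it back at its g-index.
exchange : {R : Incidence n r} {Y : Fin n → Set} (i j : Fin r) (Z : Subset n) → Acc _⊂_ Z →
           i ≢ j → (∀ e → Dec (R e i)) → (∀ e → Dec (Y e)) →
           (∀ e → e ∈ Z → ¬ Y e → ¬ R e i → ¬ Matching R (λ e' → Y e' ⊎ e' ≡ e)) →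
           Matching (R ∖ j) Y → Matching (R ∖ i) (_∈ Z) → Matching (R ∖ j) (_∈ Z)
exchange {R = R} {Y} i j Z (acc rec) i≢j R? Y? maximal G@(matching g g-ok _) F@(matching f f-ok f-inj)
  with any? (λ z → z ∈? Z ×-dec f z ≟ j)
... | no avoids =
  matching f (λ e e∈Z → proj₁ (f-ok e e∈Z) , λ eq → avoids (e , e∈Z , eq)) f-inj
... | yes (z , z∈Z , refl) with R? z
...   | yes Rzi =
  -- Moving `z` from `j` to `i`, which `f` does not use on `Z`, already frees `j`.
  insert z i _,_ (Rzi , i≢j)
    (mono (λ ((Rel , l≢i) , l≢j) → (Rel , l≢j) , l≢i) id (delete z z∈Z id F))
...   | no ¬Rzi with Y? z
...     | no ¬Yz =
  -- `G` leaves `j` free for `z`, so `Y` together with `z` would be matchable, against maximality.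
  contradiction (insert z j (λ { (inj₁ y) _ → y ; (inj₂ e≡z) e≢z → contradiction e≡z e≢z })
                   (proj₁ (f-ok z z∈Z)) G)
    (maximal z z∈Z ¬Yz ¬Rzi)
...     | yes Yz =
  -- The recursive call works with `j` deleted and has to free `g z` on the rest of `Z`. Taking `z`
  -- out of `Y` as well makes `g` avoid that index.
  insert z (g z) x∈p∧x≢y⇒x∈p-y (g-ok z Yz)
    (exchange i (g z) (Z − z) (rec (x∈p⇒p-x⊂p z∈Z)) i≢gz
      (λ e → R? e ×-dec ¬? (i ≟ j)) (λ e → Y? e ×-dec ¬? (e ≟ z)) maximal'
      (delete z Yz id G)
      (mono (λ ((Rel , l≢i) , l≢j) → (Rel , l≢j) , l≢i) id
        (delete z z∈Z (λ w → p─q⊆p Z ⁅ z ⁆ w , λ { refl → y∉p−y Z z w }) F)))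
  where
  i≢gz : i ≢ g z
  i≢gz eq = ¬Rzi (subst (R z) (sym eq) (proj₁ (g-ok z Yz)))

  -- Maximality survives only on `Z − z`: putting `z` back would give `Y`, which `G` does match
  -- without `j`. For any other `e`, a forbidden matching without `j` extends by sending `z` to `j`.
  maximal' : ∀ e → e ∈ Z − z → ¬ (Y e × e ≢ z) → ¬ (R ∖ j) e i →
             ¬ Matching (R ∖ j) (λ e' → (Y e' × e' ≢ z) ⊎ e' ≡ e)
  maximal' e e∈ ¬Y'e ¬R'ei m =
    maximal e (p─q⊆p Z ⁅ z ⁆ e∈) (λ Ye → ¬Y'e (Ye , e≢z)) (λ Rei → ¬R'ei (Rei , i≢j))
      (insert z j (λ { (inj₁ y) e'≢z → inj₁ (y , e'≢z) ; (inj₂ eq) _ → inj₂ eq }) (proj₁ (f-ok z z∈Z)) m)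
    where
    e≢z : e ≢ z
    e≢z refl = y∉p−y Z z e∈

-- Sets avoiding an index, and private sets.

Mem : SetSystem n r → Incidence n r
Mem A e l = e ∈ A l

Avoids : SetSystem n r → Fin r → Subset n → Set
Avoids A i X = Matching (Mem A ∖ i) (_∈ X)

-- Removes the dependence of a partial transversal on membership proofs. The default `d` is needed
-- because `Fin r` could be empty; its choice is immaterial.
total : {R : Incidence n r} (X : Subset n) → Fin r →
        (Σ ((e : Fin n) → e ∈ X → Fin r) λ φ → (∀ e p → R e (φ e p)) ×
          (∀ e e' (p : e ∈ X) (p' : e' ∈ X) → φ e p ≡ φ e' p' → e ≡ e')) →
        Matching R (_∈ X)
total {n} {r} {R} X d (φ , ok , inj) = matching f f-ok f-inj
  where
  f : Fin n → Fin r
  f e with e ∈? X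
  ... | yes p = φ e p
  ... | no  _ = d

  f-ok : ∀ e → e ∈ X → R e (f e)
  f-ok e e∈X with e ∈? X
  ... | yes p = ok e p
  ... | no ¬p = contradiction e∈X ¬p

  f-inj : ∀ e e' → e ∈ X → e' ∈ X → f e ≡ f e' → e ≡ e'
  f-inj e e' e∈X e'∈X eq with e ∈? X | e' ∈? X
  ... | yes p | yes p' = inj e e' p p' eq
  ... | no ¬p | _      = contradiction e∈X ¬p
  ... | _     | no ¬p  = contradiction e'∈X ¬p

toPT : (A : SetSystem n r) {X : Subset n} → Matching (Mem A) (_∈ X) → PartialTransversal A X
toPT A (matching f ok inj) = (λ e _ → f e) , ok , inj

anyVec? : {P : Vec (Fin r) n → Set} → Decidable P → Dec (∃ P)
anyVec? {n = zero} P? = map′ ([] ,_) (λ { ([] , p) → p }) (P? [])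
anyVec? {n = suc n} P? =
  map′ (λ (x , v , p) → x ∷ v , p) (λ { (x ∷ v , p) → x , v , p })
    (any? λ x → anyVec? λ v → P? (x ∷ v))

-- Exhaustive search over vectors of indices. This decidability is what allows the later arguments
-- by contradiction, and lets the example be checked by evaluation.
matching? : {R : Incidence n r} → (∀ e l → Dec (R e l)) → (X : Subset n) → Dec (Matching R (_∈ X))
matching? {n} {r} {R} R? X = map′ (λ (v , ok , inj) → matching (lookup v) ok inj) tab
  (anyVec? λ v →
    all? (λ e → e ∈? X →-dec R? e (lookup v e)) ×-dec
    all? (λ e → all? λ e' → e ∈? X →-dec (e' ∈? X →-dec (lookup v e ≟ lookup v e' →-dec e ≟ e'))))
  where
  tab : Matching R (_∈ X) →
        ∃ λ (v : Vec (Fin r) n) → (∀ e → e ∈ X → R e (lookup v e)) ×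
          (∀ e e' → e ∈ X → e' ∈ X → lookup v e ≡ lookup v e' → e ≡ e')
  tab (matching f ok inj) = tabulate f ,
    (λ e p → subst (R e) (sym (lookup∘tabulate f e)) (ok e p)) ,
    λ e e' p p' eq → inj e e' p p'
      (trans (sym (lookup∘tabulate f e)) (trans eq (lookup∘tabulate f e')))

avoids? : (A : SetSystem n r) (i : Fin r) (X : Subset n) → Dec (Avoids A i X)
avoids? A i = matching? λ e l → e ∈? A l ×-dec ¬? (l ≟ i)

Private : SetSystem n r → Fin r → Subset n → Set
Private A i Y = Avoids A i Y × (∀ k → Avoids A k Y → k ≡ i)

private? : (A : SetSystem n r) (i : Fin r) (Y : Subset n) → Dec (Private A i Y)
private? A i Y = avoids? A i Y ×-dec all? λ k → avoids? A k Y →-dec k ≟ i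

split : {e e' : Fin n} (Y : Subset n) → e' ∈ Y ∪ ⁅ e ⁆ → e' ∈ Y ⊎ e' ≡ e
split {e = e} Y e'∈ with x∈p∪q⁻ Y ⁅ e ⁆ e'∈
... | inj₁ e'∈Y = inj₁ e'∈Y
... | inj₂ e'∈e = inj₂ (x∈⁅y⁆⇒x≡y e e'∈e)

-- As long as the set is not maximal it grows by an element. Since `P` is not assumed decidable, the
-- maximal set exists only up to double negation, which suffices for proving a decidable goal.
maximal-exists : {P : Subset n → Set} (X : Subset n) → Acc _⊃_ X → P X →
                 ¬ ¬ ∃ λ Y → P Y × (∀ e → e ∉ Y → ¬ P (Y ∪ ⁅ e ⁆))
maximal-exists X (acc rec) PX none = none (X , PX , λ e e∉X PXe →
  maximal-exists (X ∪ ⁅ e ⁆)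
    (rec (p⊆p∪q ⁅ e ⁆ , e , x∈p∪q⁺ (inj₂ (x∈⁅x⁆ e)) , e∉X)) PXe none)

-- Take `Y` maximal among the matchable sets disjoint from `A i`; being disjoint, it cannot use `i`.
-- If it could also be matched without some `k` other than `i`, then `exchange` would turn every
-- matching without `i` into one without `k`.
undominated⇒private : (A : SetSystem n r) (i : Fin r) →
  (∀ j → i ≢ j → ¬ (∀ X → Avoids A i X → Avoids A j X)) → ∃ (Private A i)
undominated⇒private {n} A i undominated =
  decidable-stable (anySubset? (private? A i)) λ none →
    maximal-exists {P = P} ∅ (⊃-wellFounded ∅) P∅ λ (Y , (disjoint , matching f ok inj) , maximal) →
      none (Y ,
            matching f (λ e e∈Y → ok e e∈Y , λ eq → disjoint e e∈Y (subst (λ l → e ∈ A l) eq (ok e e∈Y))) inj ,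
            λ k avoids → decidable-stable (k ≟ i) λ k≢i →
              undominated k (k≢i ∘ sym) λ X →
                exchange i k X (⊂-wellFounded X) (k≢i ∘ sym) (λ e → e ∈? A i) (_∈? Y)
                  (λ e _ e∉Y e∉Ai m' → maximal e e∉Y
                    ((λ e' e'∈ → extended disjoint e∉Ai (split Y e'∈)) , mono id (split Y) m'))
                  avoids)
  where
  P : Subset n → Set
  P Y = (∀ e → e ∈ Y → e ∉ A i) × Matching (Mem A) (_∈ Y)

  P∅ : P ∅
  P∅ = (λ e e∈ → contradiction e∈ ∉⊥) ,
    matching (λ _ → i) (λ e e∈ → contradiction e∈ ∉⊥) λ e _ e∈ → contradiction e∈ ∉⊥

  extended : {Y : Subset n} {e e' : Fin n} → (∀ e → e ∈ Y → e ∉ A i) → e ∉ A i → e' ∈ Y ⊎ e' ≡ e → e' ∉ A i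
  extended disjoint e∉ (inj₁ e'∈Y) = disjoint _ e'∈Y
  extended disjoint e∉ (inj₂ refl) = e∉

-- If `e` lies in `A i`, it can take the free index `i`; were `e` in `Y`, this would free its old
-- index, against privacy. Conversely, removing `e` from a matching of the enlarged set leaves `Y`
-- matched without the index of `e`, which must then be `i`.
private-characterises : (A : SetSystem n r) {i : Fin r} {Y : Subset n} → Private A i Y →
  ∀ e → (e ∈ A i → e ∉ Y × PartialTransversal A (Y ∪ ⁅ e ⁆)) ×
        (e ∉ Y → PartialTransversal A (Y ∪ ⁅ e ⁆) → e ∈ A i)
private-characterises A {i} {Y} (m , only) e = forth , back
  where
  e∉Y : e ∈ A i → e ∉ Y
  e∉Y e∈Ai e∈Y =
    proj₂ (Matching.incident m e e∈Y) (only (index m e)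
      (insert e i _,_ (e∈Ai , λ eq → proj₂ (Matching.incident m e e∈Y) (sym eq))
        (mono (λ ((p , l≢i) , l≢k) → (p , l≢k) , l≢i) id (delete e e∈Y id m))))

  forth : e ∈ A i → e ∉ Y × PartialTransversal A (Y ∪ ⁅ e ⁆)
  forth e∈Ai = e∉Y e∈Ai , toPT A (insert e i rest e∈Ai m)
    where
    rest : ∀ {e'} → e' ∈ Y ∪ ⁅ e ⁆ → e' ≢ e → e' ∈ Y
    rest e'∈ e'≢e with split Y e'∈
    ... | inj₁ e'∈Y = e'∈Y
    ... | inj₂ e'≡e = contradiction e'≡e e'≢e

  back : e ∉ Y → PartialTransversal A (Y ∪ ⁅ e ⁆) → e ∈ A i
  back e∉Y t = subst (λ l → e ∈ A l) (only (index m' e) (delete e e∈ old m')) (Matching.incident m' e e∈)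
    where
    m' : Matching (Mem A) (_∈ Y ∪ ⁅ e ⁆)
    m' = total (Y ∪ ⁅ e ⁆) i t
    e∈ : e ∈ Y ∪ ⁅ e ⁆
    e∈ = x∈p∪q⁺ (inj₂ (x∈⁅x⁆ e))
    old : ∀ {e'} → e' ∈ Y → e' ∈ Y ∪ ⁅ e ⁆ × e' ≢ e
    old e'∈Y = x∈p∪q⁺ (inj₁ e'∈Y) , λ { refl → e∉Y e'∈Y }

private-unique : (A B : SetSystem n r) {i j : Fin r} {Y : Subset n} → SameMatroid A B →
                 Private A i Y → Private B j Y → A i ≡ B j
private-unique A B {i} {j} {Y} same p q = ⊆-antisym A⊆B B⊆A
  where
  A⊆B : A i ⊆ B j
  A⊆B {e} e∈ = let (e∉Y , t) = proj₁ (private-characterises A p e) e∈ in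
    proj₂ (private-characterises B q e) e∉Y (to (same _) t)
  B⊆A : B j ⊆ A i
  B⊆A {e} e∈ = let (e∉Y , t) = proj₁ (private-characterises B q e) e∈ in
    proj₂ (private-characterises A p e) e∉Y (from (same _) t)

-- Extensions by one element.

AvoidsSome : SetSystem n r → Subset r → Subset n → Set
AvoidsSome A I X = ∃ λ i → i ∈ I × Avoids A i X

-- The index of the new element `zero` lies in `I`, and by injectivity `X` is matched without it.
extend⁻ : (A : SetSystem n r) (I : Subset r) {X : Subset n} →
          PartialTransversal (extend A I) (true ∷ X) → AvoidsSome A I X
extend⁻ A I {X} (φ , ok , inj) =
  i , lookup⇒[]= i I ([]=⇒lookup (ok zero here)) ,
  total X i ((λ e p → φ (suc e) (there p)) ,
    (λ e p → drop-there (ok (suc e) (there p)) , λ eq → contradiction (inj (suc e) zero (there p) here eq) λ ()) ,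
    λ e e' p p' eq → suc-injective (inj (suc e) (suc e') (there p) (there p') eq))
  where
  i : Fin _
  i = φ zero here

extend⁺ : (A : SetSystem n r) (I : Subset r) {X : Subset n} →
          AvoidsSome A I X → PartialTransversal (extend A I) (true ∷ X)
extend⁺ {n} {r} A I {X} (i , i∈I , matching f ok inj) = toPT (extend A I) (matching g g-ok g-inj)
  where
  g : Fin (suc n) → Fin r
  g zero    = i
  g (suc e) = f e

  g-ok : ∀ e → e ∈ true ∷ X → e ∈ extend A I (g e)
  g-ok zero    _         = lookup⇒[]= zero (extend A I i) ([]=⇒lookup i∈I)
  g-ok (suc e) (there p) = there (proj₁ (ok e p))

  g-inj : ∀ e e' → e ∈ true ∷ X → e' ∈ true ∷ X → g e ≡ g e' → e ≡ e'
  g-inj zero    zero     _         _          _  = refl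
  g-inj zero    (suc e') _         (there p') eq = contradiction (sym eq) (proj₂ (ok e' p'))
  g-inj (suc e) zero     (there p) _          eq = contradiction eq (proj₂ (ok e p))
  g-inj (suc e) (suc e') (there p) (there p') eq = cong suc (inj e e' p p' eq)

-- Sets without the new element do not see `I`, so extensions of `A` can differ only on sets
-- containing it.
extend-outside : (A : SetSystem n r) (I J : Subset r) {X : Subset n} →
  PartialTransversal (extend A I) (false ∷ X) → PartialTransversal (extend A J) (false ∷ X)
extend-outside A I J (φ , ok , inj) = φ , (λ { (suc e) (there p) → there (drop-there (ok (suc e) (there p))) }) , inj

same⇒avoidsSome : (A B : SetSystem n r) {I J : Subset r} → SameMatroid (extend A I) (extend B J) →
                  ∀ {X} → AvoidsSome A I X → AvoidsSome B J X
same⇒avoidsSome A B {I} {J} same = extend⁻ B J ∘ to (same _) ∘ extend⁺ A I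

avoidsSome⇒same : (A : SetSystem n r) (I J : Subset r) →
                  (∀ {X} → AvoidsSome A I X → AvoidsSome A J X) →
                  (∀ {X} → AvoidsSome A J X → AvoidsSome A I X) →
                  SameMatroid (extend A I) (extend A J)
avoidsSome⇒same A I J I⊆J J⊆I (true  ∷ X) =
  mk⇔ (extend⁺ A J ∘ I⊆J ∘ extend⁻ A I) (extend⁺ A I ∘ J⊆I ∘ extend⁻ A J)
avoidsSome⇒same A I J I⊆J J⊆I (false ∷ X) = mk⇔ (extend-outside A I J) (extend-outside A J I)

same-sym : (A B : SetSystem n r) → SameMatroid A B → SameMatroid B A
same-sym A B same X = mk⇔ (from (same X)) (to (same X))

same-trans : (A B C : SetSystem n r) →
             SameMatroid A B → SameMatroid B C → SameMatroid A C
same-trans A B C p q X = mk⇔ (to (q X) ∘ to (p X)) (from (p X) ∘ from (q X))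

-- Injections and reindexings.

injective⇒surjective : {f : Fin n → Fin n} → Injective _≡_ _≡_ f → ∀ y → ∃ λ x → f x ≡ y
injective⇒surjective {suc n} {f} inj y = decidable-stable (any? λ x → f x ≟ y) λ missed →
  -- Punching out the missed value would inject `Fin (suc n)` into `Fin n`.
  1+n≰n (injective⇒≤ {f = λ x → punchOut {i = y} {j = f x} (λ eq → missed (x , sym eq))}
    (λ {x} {x'} → inj ∘ punchOut-injective (λ eq → missed (x , sym eq)) λ eq → missed (x' , sym eq)))

-- `Reindexing` expresses `B` through `A`, so the permutation is the inverse of `σ`.
injective⇒reindexing : (A B : SetSystem n r) (σ : Fin r → Fin r) → Injective _≡_ _≡_ σ →
                       (∀ i → A i ≡ B (σ i)) → Reindexing A B
injective⇒reindexing {r = r} A B σ inj eq =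
  permutation τ σ (λ i → inj (proj₂ (surj (σ i)))) (λ j → proj₂ (surj j)) ,
  λ j → sym (trans (eq (τ j)) (cong B (proj₂ (surj j))))
  where
  surj : ∀ j → ∃ λ i → σ i ≡ j
  surj = injective⇒surjective inj
  τ : Fin r → Fin r
  τ j = proj₁ (surj j)

-- Counting families of subsets.

-- The counts go by induction on `r`, halving the cube of subsets along its first coordinate; each
-- half is again a family of subsets of `Fin r`.
tails : Bool → List (Subset (suc r)) → List (Subset r)
tails b     []                 = []
tails true  ((true  ∷ I) ∷ Is) = I ∷ tails true Is
tails true  ((false ∷ I) ∷ Is) = tails true Is
tails false ((true  ∷ I) ∷ Is) = tails false Is
tails false ((false ∷ I) ∷ Is) = I ∷ tails false Is

length-tails : (Is : List (Subset (suc r))) → length Is ≡ length (tails true Is) + length (tails false Is)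
length-tails []                 = refl
length-tails ((true  ∷ I) ∷ Is) = cong suc (length-tails Is)
length-tails ((false ∷ I) ∷ Is) =
  trans (cong suc (length-tails Is)) (sym (+-suc (length (tails true Is)) (length (tails false Is))))

tails-all : {P : Subset (suc r) → Set} (b : Bool) (Is : List (Subset (suc r))) →
            All P Is → All (λ I → P (b ∷ I)) (tails b Is)
tails-all b     []                 []       = []
tails-all true  ((true  ∷ I) ∷ Is) (p ∷ ps) = p ∷ tails-all true Is ps
tails-all true  ((false ∷ I) ∷ Is) (p ∷ ps) = tails-all true Is ps
tails-all false ((true  ∷ I) ∷ Is) (p ∷ ps) = tails-all false Is ps
tails-all false ((false ∷ I) ∷ Is) (p ∷ ps) = p ∷ tails-all false Is ps

tails-unique : (b : Bool) (Is : List (Subset (suc r))) → Unique Is → Unique (tails b Is)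
tails-unique b     []                 []       = []
tails-unique true  ((true  ∷ I) ∷ Is) (p ∷ ps) =
  All.map (_∘ cong (true ∷_)) (tails-all true Is p) ∷ tails-unique true Is ps
tails-unique true  ((false ∷ I) ∷ Is) (p ∷ ps) = tails-unique true Is ps
tails-unique false ((true  ∷ I) ∷ Is) (p ∷ ps) = tails-unique false Is ps
tails-unique false ((false ∷ I) ∷ Is) (p ∷ ps) =
  All.map (_∘ cong (false ∷_)) (tails-all false Is p) ∷ tails-unique false Is ps

all-false⇒[] : {X : Set} {xs : List X} → All (λ _ → ⊥) xs → length xs ≡ 0
all-false⇒[] []       = refl

length-halves : (Is : List (Subset (suc r))) {c a b : ℕ} →
  c * length (tails true Is) ≤ a → c * length (tails false Is) ≤ b → c * length Is ≤ a + b
length-halves Is {c} p q rewrite length-tails Is | *-distribˡ-+ c (length (tails true Is)) (length (tails false Is)) =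
  +-mono-≤ p q

count-all : (Is : List (Subset r)) → Unique Is → length Is ≤ 2 ^ r
count-all {zero} []             _             = z≤n
count-all {zero} (_ ∷ [])       _             = ≤-refl
count-all {zero} ([] ∷ [] ∷ _)  ((p ∷ _) ∷ _) = contradiction refl p
count-all {suc r} Is u rewrite length-tails Is | +-identityʳ (2 ^ r) =
  +-mono-≤ (count-all _ (tails-unique true Is u)) (count-all _ (tails-unique false Is u))

count-fixed : (b : Bool) (i : Fin r) (Is : List (Subset r)) → Unique Is →
              All (λ I → lookup I i ≡ b) Is → 2 * length Is ≤ 2 ^ r
count-fixed {suc r} b zero Is u fixed =
  *-monoʳ-≤ 2 (≤-trans (≤-reflexive (one b fixed)) (count-all _ (tails-unique b Is u)))
  where
  one : ∀ b → All (λ I → lookup I zero ≡ b) Is → length Is ≡ length (tails b Is)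
  one true  fixed = trans (length-tails Is)
    (trans (cong (length (tails true Is) +_) (all-false⇒[] (All.map (λ ()) (tails-all false Is fixed)))) (+-identityʳ _))
  one false fixed = trans (length-tails Is)
    (cong (_+ length (tails false Is)) (all-false⇒[] (All.map (λ ()) (tails-all true Is fixed))))
count-fixed {suc r} b (suc i) Is u fixed rewrite +-identityʳ (2 ^ r) =
  length-halves Is {2}
    (count-fixed b i _ (tails-unique true Is u) (tails-all true Is fixed))
    (count-fixed b i _ (tails-unique false Is u) (tails-all false Is fixed))

-- One of the four patterns on the coordinates `i` and `j` is forbidden, which leaves three quarters
-- of the cube. If `i` or `j` is the first coordinate, one half is unrestricted and in the other the
-- remaining coordinate is fixed; otherwise both halves inherit the implication.
count-implies : (i j : Fin r) → i ≢ j → (Is : List (Subset r)) → Unique Is →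
                All (λ I → j ∈ I → i ∈ I) Is → 4 * length Is ≤ 3 * 2 ^ r
count-implies zero    zero    i≢j = contradiction refl i≢j
count-implies {suc r} zero (suc j) _ Is u imp = ≤-trans
  (length-halves Is {4} (*-monoʳ-≤ 4 (count-all _ (tails-unique true Is u)))
    (≤-trans (≤-reflexive (*-assoc 2 2 (length (tails false Is)))) (*-monoʳ-≤ 2
      (count-fixed false j _ (tails-unique false Is u) (All.map without (tails-all false Is imp))))))
  (≤-reflexive (sums (2 ^ r)))
  where
  sums : ∀ m → 4 * m + 2 * m ≡ 3 * (2 * m)
  sums = solve-∀
  without : {I : Subset r} → (suc j ∈ false ∷ I → zero ∈ false ∷ I) → lookup I j ≡ false
  without {I} f with lookup I j in eq
  ... | false = refl
  ... | true  = contradiction (f (there (lookup⇒[]= j I eq))) λ ()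
count-implies {suc r} (suc i) zero _ Is u imp = ≤-trans
  (length-halves Is {4}
    (≤-trans (≤-reflexive (*-assoc 2 2 (length (tails true Is)))) (*-monoʳ-≤ 2
      (count-fixed true i _ (tails-unique true Is u)
        (All.map (λ f → []=⇒lookup (drop-there (f here))) (tails-all true Is imp)))))
    (*-monoʳ-≤ 4 (count-all _ (tails-unique false Is u))))
  (≤-reflexive (sums (2 ^ r)))
  where
  sums : ∀ m → 2 * m + 4 * m ≡ 3 * (2 * m)
  sums = solve-∀
count-implies {suc r} (suc i) (suc j) i≢j Is u imp = ≤-trans
  (length-halves Is {4} (half true) (half false))
  (≤-reflexive (sums (2 ^ r)))
  where
  sums : ∀ m → 3 * m + 3 * m ≡ 3 * (2 * m)
  sums = solve-∀
  half : ∀ b → 4 * length (tails b Is) ≤ 3 * 2 ^ r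
  half b = count-implies i j (i≢j ∘ cong suc) _ (tails-unique b Is u)
    (All.map (λ f → drop-there ∘ f ∘ there) (tails-all b Is imp))

-- Dominated indices.

saturate : (i j : Fin r) → Subset r → Subset r
saturate i j I with j ∈? I
... | yes _ = I [ i ]≔ true
... | no  _ = I

∈-update : {i k : Fin r} {I : Subset r} → k ∈ I → k ∈ I [ i ]≔ true
∈-update {i = i} {k} {I} k∈I with k ≟ i
... | yes refl = lookup⇒[]= k _ (lookup∘update k I true)
... | no  k≢i  = lookup⇒[]= k _ (trans (lookup∘update′ k≢i I true) ([]=⇒lookup k∈I))

saturate-implies : (i j : Fin r) → i ≢ j → (I : Subset r) → j ∈ saturate i j I → i ∈ saturate i j I
saturate-implies i j i≢j I j∈ with j ∈? I
... | yes _   = lookup⇒[]= i _ (lookup∘update i I true)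
... | no  j∉I = contradiction j∈ j∉I

saturate-same : (A : SetSystem n r) (i j : Fin r) → (∀ X → Avoids A i X → Avoids A j X) →
                (I : Subset r) → SameMatroid (extend A I) (extend A (saturate i j I))
saturate-same A i j dom I with j ∈? I
... | no  _   = λ X → mk⇔ id id
... | yes j∈I = avoidsSome⇒same A I (I [ i ]≔ true) (λ (k , k∈I , a) → k , ∈-update k∈I , a) back
  where
  back : ∀ {X} → AvoidsSome A (I [ i ]≔ true) X → AvoidsSome A I X
  back (k , k∈ , a) with k ≟ i
  -- The added index `i` can be traded for `j`, which was in `I` already.
  ... | yes refl = j , j∈I , dom _ a
  ... | no  k≢i  = k , lookup⇒[]= k I (trans (sym (lookup∘update′ k≢i I true)) ([]=⇒lookup k∈)) , a

Distinct : SetSystem n r → List (Subset r) → Set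
Distinct A = AllPairs (λ I I' → ¬ SameMatroid (extend A I) (extend A I'))

distinct⇒unique : (A : SetSystem n r) {Is : List (Subset r)} → Distinct A Is → Unique Is
distinct⇒unique A = AllPairs.map λ { ¬same refl → ¬same λ X → mk⇔ id id }

-- Saturating the index sets leaves the matroids unchanged, so distinct matroids still have distinct
-- index sets, and these now obey the implication from `j` to `i`.
count-dominated : (A : SetSystem n r) (i j : Fin r) → i ≢ j → (∀ X → Avoids A i X → Avoids A j X) →
                  (Is : List (Subset r)) → Distinct A Is → 4 * length Is ≤ 3 * 2 ^ r
count-dominated {r = r} A i j i≢j dom Is distinct =
  subst (λ l → 4 * l ≤ 3 * 2 ^ r) (length-map (saturate i j) Is)
    (count-implies i j i≢j (map (saturate i j) Is)
      (AllPairs.map⁺ (AllPairs.map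
        (λ {I} {I'} ¬same eq → ¬same (same-trans (extend A I) (extend A (saturate i j I')) (extend A I')
          (subst (λ K → SameMatroid (extend A I) (extend A K)) eq (saturate-same A i j dom I))
          (same-sym (extend A I') (extend A (saturate i j I')) (saturate-same A i j dom I'))))
        distinct))
      (All.map⁺ (All.universal (saturate-implies i j i≢j) Is)))

-- A dominated index of `B` bounds families of extensions of `B`; this carries the common family
-- over to `B` without loss of length.
transfer : (A B : SetSystem n r) (Is : List (Subset r)) → All (InBoth A B) Is → Distinct A Is →
           ∃ λ Js → length Js ≡ length Is × Distinct B Js
transfer A B Is common distinct = let (Js , eq , d , _) = go Is common distinct in Js , eq , d
  where
  go : ∀ Is → All (InBoth A B) Is → Distinct A Is →
       ∃ λ Js → length Js ≡ length Is × Distinct B Js ×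
         -- Strengthens the induction: a matroid distinct from all those of `Is` stays distinct from
         -- those of `Js` when it is written as an extension of `B`.
         (∀ I J → SameMatroid (extend A I) (extend B J) →
           All (λ I' → ¬ SameMatroid (extend A I) (extend A I')) Is →
           All (λ J' → ¬ SameMatroid (extend B J) (extend B J')) Js)
  go []       []             []       = [] , refl , [] , λ _ _ _ _ → []
  go (I ∷ Is) ((J , s) ∷ ss) (d ∷ ds) with go Is ss ds
  ... | Js , eq , ds' , lift = J ∷ Js , cong suc eq , lift I J s d ∷ ds' ,
    λ { I' J' t (p ∷ ps) →
      (λ same → p (same-trans (extend A I') (extend B J') (extend A I) t
        (same-trans (extend B J') (extend B J) (extend A I) same (same-sym (extend A I) (extend B J) s)))) ∷
      lift I' J' t ps }

-- Comparing the private sets of the two presentations.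

module _ (A B : SetSystem n r) {Y Y' : Fin r → Subset n}
         (pA : ∀ i → Private A i (Y i)) (pB : ∀ j → Private B j (Y' j)) where

  -- `Y i` witnesses `i` in the extension, so `B` matches it without some `j` in `J`; then `Y' j` is
  -- a witness in turn, and leads back to an index in `I`.
  common-∈⁻ : {I : Subset r} → InBoth A B I → ∀ {i} → i ∈ I →
              ∃ λ i' → i' ∈ I × ∃ λ j → Avoids B j (Y i) × Avoids A i' (Y' j)
  common-∈⁻ {I} (J , same) {i} i∈I
    with same⇒avoidsSome A B {I} {J} same (i , i∈I , proj₁ (pA i))
  ... | j , j∈J , b with same⇒avoidsSome B A {J} {I} (same-sym (extend A I) (extend B J) same) (j , j∈J , proj₁ (pB j))
  ...   | i' , i'∈I , a = i' , i'∈I , j , b , a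

  -- The way back: `Y' j` is independent together with the new element, and its privacy puts `j`
  -- into `J`; hence so is `Y i`, whose privacy puts `i` into `I`.
  common-∈⁺ : {I : Subset r} → InBoth A B I → ∀ {i i' j} → i' ∈ I →
              Avoids B j (Y i) → Avoids A i' (Y' j) → i ∈ I
  common-∈⁺ {I} (J , same) {i} {i'} {j} i'∈I b a
    with same⇒avoidsSome A B {I} {J} same (i' , i'∈I , a)
  ... | k , k∈J , b' with refl ← proj₂ (pB j) k b'
    with same⇒avoidsSome B A {J} {I} (same-sym (extend A I) (extend B J) same) (j , k∈J , b)
  ...   | l , l∈I , a' with refl ← proj₂ (pA i) l a' = l∈I

  module _ (same : SameMatroid A B) {Is : List (Subset r)}
           (common : All (InBoth A B) Is) (unique : Unique Is)
           (¬bound : ¬ (4 * length Is ≤ 3 * 2 ^ r)) where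

    diagonal : ∀ i i' j → Avoids B j (Y i) → Avoids A i' (Y' j) → i' ≡ i
    diagonal i i' j b a = decidable-stable (i' ≟ i) λ i'≢i →
      ¬bound (count-implies i i' (i'≢i ∘ sym) Is unique
        (All.map (λ {I} c i'∈I → common-∈⁺ {I} c i'∈I b a) common))

    Linked : Fin r → Set
    Linked i = ∃ λ j → Avoids B j (Y i) × Avoids A i (Y' j)

    absent : ∀ i → ¬ Linked i → {I : Subset r} → InBoth A B I → lookup I i ≡ false
    absent i none {I} c with lookup I i in eq
    ... | false = refl
    -- If `i` were in `I`, the index `i'` reached by going to `B` and back would equal `i` by
    -- `diagonal`, which would link `i`.
    ... | true with common-∈⁻ {I} c (lookup⇒[]= i I eq)
    ...   | i' , _ , j , b , a with refl ← diagonal i i' j b a = contradiction (j , b , a) none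

    linked : ∀ i → Linked i
    linked i = decidable-stable (any? λ j → avoids? B j (Y i) ×-dec avoids? A i (Y' j)) λ none →
      ¬bound (begin
        4 * length Is        ≡⟨ *-assoc 2 2 (length Is) ⟩
        2 * (2 * length Is)  ≤⟨ *-monoʳ-≤ 2 (count-fixed false i Is unique (All.map (λ {I} → absent i none {I}) common)) ⟩
        2 * 2 ^ r            ≤⟨ *-monoˡ-≤ (2 ^ r) (n≤1+n 2) ⟩
        3 * 2 ^ r            ∎)
      where open ≤-Reasoning

    private⇒reindexing : Reindexing A B
    private⇒reindexing = injective⇒reindexing A B (proj₁ ∘ linked) σ-injective A≡B∘σ
      where
      σ-injective : Injective _≡_ _≡_ (proj₁ ∘ linked)
      -- If `i` and `i'` share `j`, the first half of one link and the second half of the other form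
      -- a pair to which `diagonal` applies.
      σ-injective {i} {i'} eq = let (j , b , _) = linked i ; (_ , _ , a) = linked i' in
        sym (diagonal i i' j b (subst (λ j → Avoids A i' (Y' j)) (sym eq) a))

      A≡B∘σ : ∀ i → A i ≡ B (proj₁ (linked i))
      A≡B∘σ i = let (j , b , a) = linked i in
        -- The common private set is `Y' j`: any index of `A` that it avoids is equal to `i` by
        -- `diagonal`.
        private-unique A B same (a , λ k a' → diagonal i k j b a') (pB j)

upper-bound : (A B : SetSystem n r) → SameMatroid A B → ¬ Reindexing A B →
              (Is : List (Subset r)) → DistinctCommon A B Is → 4 * length Is ≤ 3 * 2 ^ r
upper-bound {r = r} A B same ¬reindexing Is (common , distinct) =
  decidable-stable (4 * length Is ≤? 3 * 2 ^ r) λ ¬bound →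
    ¬reindexing (private⇒reindexing A B
      (λ i → proj₂ (privateA ¬bound i)) (λ j → proj₂ (privateB ¬bound j))
      same common (distinct⇒unique A distinct) ¬bound)
  where
  privateA : ¬ (4 * length Is ≤ 3 * 2 ^ r) → ∀ i → ∃ (Private A i)
  privateA ¬bound i = undominated⇒private A i λ j i≢j dom →
    ¬bound (count-dominated A i j i≢j dom Is distinct)

  privateB : ¬ (4 * length Is ≤ 3 * 2 ^ r) → ∀ j → ∃ (Private B j)
  privateB ¬bound j = undominated⇒private B j λ k j≢k dom →
    let (Js , eq , d) = transfer A B Is common distinct in
    ¬bound (subst (λ l → 4 * l ≤ 3 * 2 ^ r) eq (count-dominated B j k j≢k dom Js d))

-- The example attaining the bound.

-- Having at least one index provides the default for `total`.
partialTransversal? : (A : SetSystem n (suc r)) (X : Subset n) → Dec (PartialTransversal A X)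
partialTransversal? A X = map′ (toPT A) (total X zero) (matching? (λ e l → e ∈? A l) X)

allSubset? : {P : Subset n → Set} → Decidable P → Dec (∀ X → P X)
allSubset? P? = map′ (λ none X → decidable-stable (P? X) λ ¬p → none (X , ¬p))
  (λ all (X , ¬p) → ¬p (all X)) (¬? (anySubset? (¬? ∘ P?)))

sameMatroid? : (A B : SetSystem n (suc r)) → Dec (SameMatroid A B)
sameMatroid? A B = allSubset? λ X → map′ (λ (f , g) → mk⇔ f g) (λ e → to e , from e)
  ((partialTransversal? A X →-dec partialTransversal? B X) ×-dec
   (partialTransversal? B X →-dec partialTransversal? A X))

-- Both present the free matroid of rank 2. In `nested`, a set avoiding the first index also avoids
-- the second, so only three extensions arise: the new element is a loop, parallel to the first
-- element, or in general position.
singletons nested : SetSystem 2 2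
singletons zero       = true ∷ false ∷ []
singletons (suc zero) = false ∷ true ∷ []
nested zero       = true ∷ true ∷ []
nested (suc zero) = false ∷ true ∷ []

-- These give the three extensions just named. The omitted index set makes the new element parallel
-- to the second element, which `nested` cannot achieve.
sharp-indices : List (Subset 2)
sharp-indices = (false ∷ false ∷ []) ∷ (true ∷ false ∷ []) ∷ (true ∷ true ∷ []) ∷ []

sharp-hyp : Hyp singletons nested
sharp-hyp =
  (true ∷ true ∷ [] , refl , toWitness {a? = partialTransversal? singletons _} tt) ,
  toWitness {a? = sameMatroid? singletons nested} tt ,
  λ (τ , eq) → nested≢ (τ ⟨$⟩ʳ zero) (eq zero)
  where
  nested≢ : ∀ k → nested zero ≢ singletons k
  nested≢ zero       ()
  nested≢ (suc zero) ()

sharp-common : DistinctCommon singletons nested sharp-indices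
sharp-common = toWitness {a? = All.all? common? sharp-indices} tt ,
               toWitness {a? = AllPairs.allPairs? distinct? sharp-indices} tt
  where
  common? : ∀ I → Dec (InBoth singletons nested I)
  common? I = anySubset? λ J → sameMatroid? (extend singletons I) (extend nested J)
  distinct? : ∀ I I' → Dec (¬ SameMatroid (extend singletons I) (extend singletons I'))
  distinct? I I' = ¬? (sameMatroid? (extend singletons I) (extend singletons I'))

theorem4p5 : (∀ (n r : ℕ) (A B : SetSystem n r) → Hyp A B →
    ∀ (Is : List (Subset r)) → DistinctCommon A B Is →
    4 * length Is ≤ 3 * 2 ^ r)
    ×
    (∃ λ (n : ℕ) → ∃ λ (r : ℕ) → Σ (SetSystem n r) λ A → Σ (SetSystem n r) λ B →
    Hyp A B × Σ (List (Subset r)) λ Is → DistinctCommon A B Is × 4 * length Is ≡ 3 * 2 ^ r)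
theorem4p5 =
  (λ n r A B (_ , same , ¬reindexing) → upper-bound A B same ¬reindexing) ,
  2 , 2 , singletons , nested , sharp-hyp , sharp-indices , sharp-common , refl
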